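{- Let $p\ge3$ be a prime. (1) $\displaystyle \mathrm{ord}_p(\overline{F}_{p^2-1})=\sum_{k=1}^{p-1}\mu(k)\,\mathrm{ord}_p\big(\overline{G}_{\lfloor (p^2-1)/k\rfloor}\big).$ (2) For $1\le k\le p-1$ write $\lfloor (p^2-1)/k\rfloor=a_kp+b_k$ with $0\le a_k,b_k\le p-1$. Then $\mathrm{ord}_p\big(\overline{G}_{\lfloor (p^2-1)/k\rfloor}\big)=a_k(p-1-b_k)$, where $a_k=\lfloor (p-1)/k\rfloor$ and $b_k=\lfloor (p^2-1)/k\rfloor-p\lfloor (p-1)/k\rfloor$. (3) $\displaystyle \mathrm{ord}_p(\overline{F}_{p^2-1})=(p-1)-\sum_{k=1}^{p-1}\mu(k)\Big\lfloor\frac{p-1}{k}\Big\rfloor b_k.$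
   Context: For a positive integer $m$, $\overline{F}_m=\Big(\prod_{1\le h\le k\le m,\ \gcd(h,k)=1}\frac{h}{k}\Big)^{ -1}$ (reciprocal of the product of all nonzero Farey fractions of order $m$) and $\overline{G}_m=\Big(\prod_{1\le h\le k\le m}\frac{h}{k}\Big)^{ -1}$ (reciprocal of the product of all reduced and unreduced fractions $h/k$ with $1\le h\le k\le m$). For a nonzero rational $x$, $\mathrm{ord}_p(x)$ is the exponent of $p$ in $x$. $\mu$ is the M\"obius function. -}

module Defs where

open import Data.Bool.Base using (if_then_else_)
open import Data.Integer.Base as ℤ using (ℤ; +_)
open import Data.List.Base using (List; []; _∷_; concatMap; filter; foldr; length; map; upTo)
open import Data.List.Relation.Unary.Unique.DecPropositional using (unique?)
open import Data.Nat.Base as ℕ using (ℕ; suc)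
open import Data.Nat.GCD using (gcd)
open import Data.Nat.Primality.Factorisation using (factorise; factors)
open import Data.Nat.Properties using (_≟_)
open import Data.Product.Base using (_×_; _,_)
open import Data.Rational.Base as ℚ using (ℚ; 1ℚ; 1/_; ↥_; ↧ₙ_)
open import Data.Rational.Properties using (normalize-pos; pos*pos⇒pos; pos⇒nonZero; 1/pos⇒pos)
open import Relation.Nullary.Decidable.Core using (does)

-- Σ_{k=1}^{n} f k
∑₁ : (n : ℕ) → ((k : ℕ) .{{_ : ℕ.NonZero k}} → ℤ) → ℤ
∑₁ n f = foldr ℤ._+_ (+ 0) (map (λ i → f (suc i)) (upTo n))

-- `factorise` lists prime factors with multiplicity, so its factors are
-- pairwise distinct exactly when n is squarefree.
μ : (n : ℕ) .{{_ : ℕ.NonZero n}} → ℤ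
μ n = if does (unique? _≟_ ps) then ℤ.-1ℤ ℤ.^ length ps else + 0
  where ps = factors (factorise n)

-- The exponent of p in the prime factorisation of n; meaningful for p prime.
ordℕ : (p n : ℕ) .{{_ : ℕ.NonZero n}} → ℕ
ordℕ p n = length (filter (p ≟_) (factors (factorise n)))

ord : (p : ℕ) (x : ℚ) .{{_ : ℚ.NonZero x}} → ℤ
ord p x@record{} = + ordℕ p ℤ.∣ ↥ x ∣ ℤ.- + ordℕ p (↧ₙ x)

-- The pair (i , j) encodes h = suc i, k = suc j, which makes the denominator
-- visibly nonzero; the bound h ≤ k reads i < suc j.
indices : ℕ → List (ℕ × ℕ)
indices m = concatMap (λ j → map (_, j) (upTo (suc j))) (upTo m)

coprimeIndices : ℕ → List (ℕ × ℕ)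
coprimeIndices m = filter (λ (i , j) → gcd (suc i) (suc j) ≟ 1) (indices m)

fraction : ℕ × ℕ → ℚ
fraction (i , j) = + suc i ℚ./ suc j

∏fractions : List (ℕ × ℕ) → ℚ
∏fractions ijs = foldr ℚ._*_ 1ℚ (map fraction ijs)

∏fractions-pos : ∀ ijs → ℚ.Positive (∏fractions ijs)
∏fractions-pos []              = _
∏fractions-pos ((i , j) ∷ ijs) =
  pos*pos⇒pos (fraction (i , j)) {{normalize-pos (suc i) (suc j)}}
              (∏fractions ijs)   {{∏fractions-pos ijs}}

1/∏fractions : List (ℕ × ℕ) → ℚ
1/∏fractions ijs = (1/ ∏fractions ijs) {{pos⇒nonZero (∏fractions ijs) {{∏fractions-pos ijs}}}}

1/∏fractions-nonZero : ∀ ijs → ℚ.NonZero (1/∏fractions ijs)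
1/∏fractions-nonZero ijs =
  pos⇒nonZero (1/∏fractions ijs)
    {{1/pos⇒pos (∏fractions ijs) {{∏fractions-pos ijs}}}}

F̅ : ℕ → ℚ
F̅ m = 1/∏fractions (coprimeIndices m)

G̅ : ℕ → ℚ
G̅ m = 1/∏fractions (indices m)

-- Not declared as instances: ℚ.NonZero unfolds to ℕ.NonZero, so they would be
-- candidates in every search for a nonzero natural.
F̅-nonZero : ∀ m → ℚ.NonZero (F̅ m)
F̅-nonZero m = 1/∏fractions-nonZero (coprimeIndices m)

G̅-nonZero : ∀ m → ℚ.NonZero (G̅ m)
G̅-nonZero m = 1/∏fractions-nonZero (indices m)

ordF̅ : (p m : ℕ) → ℤ
ordF̅ p m = ord p (F̅ m) {{F̅-nonZero m}}

ordG̅ : (p m : ℕ) → ℤ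
ordG̅ p m = ord p (G̅ m) {{G̅-nonZero m}}

{-# OPTIONS --safe #-}
module Submission where

open import Defs
open import Data.Nat.Base using (ℕ; NonZero; _∸_; _^_; _/_; _≤_) renaming (_+_ to _+ℕ_; _*_ to _*ℕ_)
open import Data.Nat.Primality using (Prime)
open import Data.Integer.Base using (+_; _-_; _*_)
open import Data.Product.Base using (_×_; ∃₂)
open import Relation.Binary.PropositionalEquality.Core using (_≡_)

open import Algebra.Properties.CommutativeSemigroup using (interchange)
open import Data.Bool.Base using (if_then_else_)
open import Data.Integer.Base as ℤ using (ℤ; +[1+_]; _+_; -_)
open import Data.Integer.Properties as ℤ using (+-commutativeSemigroup)
open import Data.Integer.Tactic.RingSolver using (solve-∀)
open import Data.List.Base using (List; []; _∷_; _++_; concatMap; filter; foldr; length; map; upTo)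
open import Data.List.Membership.Propositional using (_∈_; _∉_)
open import Data.List.Properties
  using (filter-++; filter-accept; filter-none; length-++; map-++; map-cong; map-∘; upTo-∷ʳ)
open import Data.List.Relation.Binary.Permutation.Propositional using (_↭_; ↭-sym; ↭⇒↭ₛ)
open import Data.List.Relation.Binary.Permutation.Propositional.Properties using (filter-↭; ↭-length)
import Data.List.Relation.Binary.Permutation.Setoid.Properties as Permutationₛ
open import Data.List.Relation.Unary.All as All using (_∷_)
open import Data.List.Relation.Unary.All.Properties using (All¬⇒¬Any; ++⁺; ¬Any⇒All¬)
open import Data.List.Relation.Unary.AllPairs using (_∷_)
open import Data.List.Relation.Unary.Unique.DecPropositional using (unique?)
open import Data.List.Relation.Unary.Unique.Propositional using (Unique)
open import Data.Nat.Base as ℕ using (suc; s≤s; s≤s⁻¹; zero; z≤n; _%_; _<_)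
open import Data.Nat.Divisibility
open import Data.Nat.DivMod
open import Data.Nat.GCD using (gcd; gcd-greatest; gcd[m,n]∣m; gcd[m,n]∣n; gcd[m,n]≢0; gcd[m,n]≤n)
open import Data.Nat.ListAction using (product)
open import Data.Nat.ListAction.Properties using (product-++; ∈⇒∣product)
open import Data.Nat.Primality using (euclidsLemma; prime⇒nonZero)
open import Data.Nat.Primality.Factorisation
open import Data.Nat.Properties as ℕ using ()
open import Data.Nat.Tactic.RingSolver using () renaming (solve-∀ to solve-∀ℕ)
open import Data.Product.Base using (_,_; ∃)
open import Data.Rational.Base as ℚ using (mkℚ; toℚᵘ; 1/_)
open import Data.Rational.Properties using (normalize-pos; pos⇒nonZero; toℚᵘ-fromℚᵘ; toℚᵘ-homo-*)
open import Data.Rational.Unnormalised.Base as ℚᵘ using (mkℚᵘ; ℚᵘ; ↥_; ↧ₙ_; *≡*)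
open import Data.Sum.Base using (inj₁; inj₂)
open import Function.Base using (_∘_)
open import Function.Bundles using (mk⇔)
open import Relation.Binary.PropositionalEquality
  using (_≢_; cong; cong₂; refl; setoid; subst; sym; trans; module ≡-Reasoning)
open import Relation.Nullary using (Dec; contradiction; does; no; yes; ¬_)
open import Relation.Nullary.Decidable using (dec-false; dec-true; does-⇔)
open import Relation.Unary using (Decidable; Pred)
open PrimeFactorisation using (factorsPrime; isFactorisation)

-- Since ord_p(h/k) is unchanged when h and k are multiplied by a common factor,
-- expanding [gcd(h,k) = 1] = Σ_{d ∣ gcd(h,k)} μ(d) and collecting the terms with
-- the same d gives ord_p F̅_n = Σ_{d ≤ n} μ(d) ord_p G̅_{⌊n/d⌋}.  On the other hand
-- ord_p G̅_n = Σ_{k ≤ n} ord_p(k) (2k − n − 1); for n = a p + b < p² only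
-- k = p, 2p, …, a p contribute, each with ord_p(k) = 1, so the sum is
-- a (p − 1 − b).  This vanishes for n < p, which cuts the sum over d off at p − 1,
-- and (3) follows from Σ_{k ≤ n} μ(k) ⌊n/k⌋ = 1.

-- Sums over 1 ≤ k ≤ n

-- The index carries a nonzero instance because `μ`, `ordℕ` and division by the index ask for one;
-- the shape agrees with the argument of `∑₁`.
Summand : Set
Summand = (k : ℕ) .{{_ : NonZero k}} → ℤ

private
  variable
    A B : Set
    m n : ℕ
    f g : Summand

-- Iverson bracket. A condition becomes an integer factor, so a restricted sum stays a sum over a
-- whole initial range and can be interchanged with others.
𝟙 : Dec A → ℤ
𝟙 a? = if does a? then + 1 else + 0

𝟙-true : (a? : Dec A) → A → 𝟙 a? ≡ + 1
𝟙-true a? a rewrite dec-true a? a = refl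

𝟙-false : (a? : Dec A) → ¬ A → 𝟙 a? ≡ + 0
𝟙-false a? ¬a rewrite dec-false a? ¬a = refl

𝟙*-true : (a? : Dec A) → A → ∀ i → 𝟙 a? * i ≡ i
𝟙*-true a? a i = trans (cong (_* i) (𝟙-true a? a)) (ℤ.*-identityˡ i)

𝟙*-false : (a? : Dec A) → ¬ A → ∀ i → 𝟙 a? * i ≡ + 0
𝟙*-false a? ¬a i = cong (_* i) (𝟙-false a? ¬a)

𝟙-⇔ : (a? : Dec A) (b? : Dec B) → (A → B) → (B → A) → 𝟙 a? ≡ 𝟙 b?
𝟙-⇔ a? b? a⇒b b⇒a = cong (if_then + 1 else + 0) (does-⇔ (mk⇔ a⇒b b⇒a) a? b?)

∑ₗ : List ℤ → ℤ
∑ₗ = foldr _+_ (+ 0)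

∑ₗ-++ : ∀ xs ys → ∑ₗ (xs ++ ys) ≡ ∑ₗ xs + ∑ₗ ys
∑ₗ-++ []       ys = sym (ℤ.+-identityˡ _)
∑ₗ-++ (x ∷ xs) ys = trans (cong (_+_ x) (∑ₗ-++ xs ys)) (sym (ℤ.+-assoc x _ _))

∑ₗ-concatMap : (c : B → ℤ) (h : A → List B) (xs : List A) →
  ∑ₗ (map c (concatMap h xs)) ≡ ∑ₗ (map (λ x → ∑ₗ (map c (h x))) xs)
∑ₗ-concatMap c h []       = refl
∑ₗ-concatMap c h (x ∷ xs) = begin
  ∑ₗ (map c (h x ++ concatMap h xs))                ≡⟨ cong ∑ₗ (map-++ c (h x) _) ⟩
  ∑ₗ (map c (h x) ++ map c (concatMap h xs))        ≡⟨ ∑ₗ-++ (map c (h x)) _ ⟩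
  ∑ₗ (map c (h x)) + ∑ₗ (map c (concatMap h xs))    ≡⟨ cong (_+_ (∑ₗ (map c (h x)))) (∑ₗ-concatMap c h xs) ⟩
  ∑ₗ (map (λ y → ∑ₗ (map c (h y))) (x ∷ xs))        ∎
  where open ≡-Reasoning

∑ₗ-filter : {P : Pred A _} (P? : Decidable P) (c : A → ℤ) (xs : List A) →
  ∑ₗ (map c (filter P? xs)) ≡ ∑ₗ (map (λ x → 𝟙 (P? x) * c x) xs)
∑ₗ-filter P? c []       = refl
∑ₗ-filter P? c (x ∷ xs) with P? x
... | yes _ = cong₂ _+_ (sym (ℤ.*-identityˡ (c x))) (∑ₗ-filter P? c xs)
... | no  _ = trans (∑ₗ-filter P? c xs) (sym (ℤ.+-identityˡ _))

-- Unlike `∑₁`, which folds from the front, this splits off the last term, as induction on the upper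
-- bound requires.
∑ : ℕ → Summand → ℤ
∑ zero    f = + 0
∑ (suc n) f = ∑ n f + f (suc n)

∑₁≡∑ : ∀ n (f : Summand) → ∑₁ n f ≡ ∑ n f
∑₁≡∑ zero    f = refl
∑₁≡∑ (suc n) f = begin
  ∑ₗ (map f⁺ (upTo (suc n)))               ≡⟨ cong (λ is → ∑ₗ (map f⁺ is)) (upTo-∷ʳ n) ⟨
  ∑ₗ (map f⁺ (upTo n ++ n ∷ []))           ≡⟨ cong ∑ₗ (map-++ f⁺ (upTo n) (n ∷ [])) ⟩
  ∑ₗ (map f⁺ (upTo n) ++ f (suc n) ∷ [])   ≡⟨ ∑ₗ-++ (map f⁺ (upTo n)) _ ⟩
  ∑₁ n f + (f (suc n) + + 0)               ≡⟨ cong₂ _+_ (∑₁≡∑ n f) (ℤ.+-identityʳ (f (suc n))) ⟩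
  ∑ n f + f (suc n)                        ∎
  where
  open ≡-Reasoning
  f⁺ : ℕ → ℤ
  f⁺ i = f (suc i)

∑-cong : ∀ n → ((k : ℕ) .{{_ : NonZero k}} → k ≤ n → f k ≡ g k) → ∑ n f ≡ ∑ n g
∑-cong zero    f≗g = refl
∑-cong (suc n) f≗g = cong₂ _+_ (∑-cong n λ k k≤n → f≗g k (ℕ.m≤n⇒m≤1+n k≤n)) (f≗g (suc n) ℕ.≤-refl)

∑-0 : ∀ n → ∑ n (λ _ → + 0) ≡ + 0
∑-0 zero    = refl
∑-0 (suc n) = cong (_+ + 0) (∑-0 n)

∑-const : ∀ n c → ∑ n (λ _ → c) ≡ + n * c
∑-const zero    c = refl
∑-const (suc n) c = trans (cong (_+ c) (∑-const n c)) (distrib (+ n) c)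
  where
  distrib : ∀ i c → i * c + c ≡ (+ 1 + i) * c
  distrib = solve-∀

∑-+ : ∀ n (f g : Summand) → ∑ n (λ k → f k + g k) ≡ ∑ n f + ∑ n g
∑-+ zero    f g = refl
∑-+ (suc n) f g = trans (cong (_+ (f (suc n) + g (suc n))) (∑-+ n f g))
                        (interchange +-commutativeSemigroup (∑ n f) _ _ _)

∑-*ˡ : ∀ n c (f : Summand) → ∑ n (λ k → c * f k) ≡ c * ∑ n f
∑-*ˡ zero    c f = sym (ℤ.*-zeroʳ c)
∑-*ˡ (suc n) c f = trans (cong (_+ c * f (suc n)) (∑-*ˡ n c f)) (sym (ℤ.*-distribˡ-+ c (∑ n f) _))

∑-*ʳ : ∀ n c (f : Summand) → ∑ n (λ k → f k * c) ≡ ∑ n f * c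
∑-*ʳ zero    c f = refl
∑-*ʳ (suc n) c f = trans (cong (_+ f (suc n) * c) (∑-*ʳ n c f)) (sym (ℤ.*-distribʳ-+ c (∑ n f) _))

∑-neg : ∀ n (f : Summand) → ∑ n (λ k → - f k) ≡ - ∑ n f
∑-neg zero    f = refl
∑-neg (suc n) f = trans (cong (_+ - f (suc n)) (∑-neg n f)) (sym (ℤ.neg-distrib-+ (∑ n f) _))

∑-- : ∀ n (f g : Summand) → ∑ n (λ k → f k - g k) ≡ ∑ n f - ∑ n g
∑-- n f g = trans (∑-+ n f (λ k → - g k)) (cong (_+_ (∑ n f)) (∑-neg n g))

∑-comm : ∀ m n (f : (i : ℕ) .{{_ : NonZero i}} → Summand) →
  ∑ m (λ i → ∑ n (λ j → f i j)) ≡ ∑ n (λ j → ∑ m (λ i → f i j))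
∑-comm zero    n f = sym (∑-0 n)
∑-comm (suc m) n f = trans (cong (_+ ∑ n (f (suc m))) (∑-comm m n f))
                           (sym (∑-+ n (λ j → ∑ m (λ i → f i j)) (f (suc m))))

∑-truncate : ∀ n (f : Summand) → m ≤ n →
  ((k : ℕ) .{{_ : NonZero k}} → m < k → k ≤ n → f k ≡ + 0) → ∑ n f ≡ ∑ m f
∑-truncate zero f z≤n _ = refl
∑-truncate {m} (suc n) f m≤1+n f≗0 with ℕ.m≤n⇒m<n∨m≡n m≤1+n
... | inj₂ refl  = refl
... | inj₁ m<1+n = begin
  ∑ n f + f (suc n)  ≡⟨ cong₂ _+_ (∑-truncate n f (s≤s⁻¹ m<1+n) (λ k m<k k≤n → f≗0 k m<k (ℕ.m≤n⇒m≤1+n k≤n)))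
                                  (f≗0 (suc n) m<1+n ℕ.≤-refl) ⟩
  ∑ m f + + 0        ≡⟨ ℤ.+-identityʳ _ ⟩
  ∑ m f              ∎
  where open ≡-Reasoning

-- Sums over the multiples of d

at-multiples : (d : ℕ) .{{_ : NonZero d}} → Summand → Summand
at-multiples d f j = f (d *ℕ j) {{ℕ.m*n≢0 d j}}

[r+qd]/d≡q : ∀ {r} q d .{{_ : NonZero d}} → r < d → (r +ℕ q *ℕ d) / d ≡ q
[r+qd]/d≡q {r} q d r<d = begin
  (r +ℕ q *ℕ d) / d      ≡⟨ +-distrib-/-∣ʳ r (n∣m*n q) ⟩
  r / d +ℕ q *ℕ d / d    ≡⟨ cong₂ _+ℕ_ (m<n⇒m/n≡0 r<d) (m*n/n≡m q d) ⟩
  q                      ∎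
  where open ≡-Reasoning

-- Induction on n: ⌊n/d⌋ grows by one exactly when d divides n + 1, and only then does `f (suc n)`
-- enter the sum.
∑-multiples : ∀ d .{{_ : NonZero d}} n (f : Summand) →
  ∑ n (λ k → 𝟙 (d ∣? k) * f k) ≡ ∑ (n / d) (at-multiples d f)
∑-multiples d zero    f = cong (λ q → ∑ q (at-multiples d f)) (sym (0/n≡0 d))
∑-multiples d@(suc d′) (suc n) f =
  trans (cong (_+ 𝟙 (d ∣? suc n) * f (suc n)) (∑-multiples d n f)) (step (d ∣? suc n))
  where
  open ≡-Reasoning
  f′ : Summand
  f′ = at-multiples d f

  step : Dec (d ∣ suc n) → ∑ (n / d) f′ + 𝟙 (d ∣? suc n) * f (suc n) ≡ ∑ (suc n / d) f′
  step (no d∤1+n) = begin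
    ∑ (n / d) f′ + 𝟙 (d ∣? suc n) * f (suc n)  ≡⟨ cong (_+_ (∑ (n / d) f′)) (𝟙*-false (d ∣? suc n) d∤1+n _) ⟩
    ∑ (n / d) f′ + + 0                         ≡⟨ ℤ.+-identityʳ _ ⟩
    ∑ (n / d) f′                               ≡⟨ cong (λ q → ∑ q f′) 1+n/d≡n/d ⟨
    ∑ (suc n / d) f′                           ∎
    where
    1+n≡ : suc n ≡ suc (n % d) +ℕ n / d *ℕ d
    1+n≡ = cong suc (m≡m%n+[m/n]*n n d)

    1+r≢d : suc (n % d) ≢ d
    1+r≢d 1+r≡d = d∤1+n (divides (suc (n / d)) (trans 1+n≡ (cong (_+ℕ n / d *ℕ d) 1+r≡d)))

    -- The remainder of n can grow by one without reaching d, so the quotient stays the same.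
    1+n/d≡n/d : suc n / d ≡ n / d
    1+n/d≡n/d = trans (cong (_/ d) 1+n≡) ([r+qd]/d≡q (n / d) d (ℕ.≤∧≢⇒< (m%n<n n d) 1+r≢d))
  step (yes (divides (suc c) refl)) = begin
    ∑ (n / d) f′ + 𝟙 (d ∣? suc n) * f (suc c *ℕ d)
      ≡⟨ cong₂ _+_ (cong (λ q → ∑ q f′) ([r+qd]/d≡q c d ℕ.≤-refl)) (𝟙*-true (d ∣? suc n) (n∣m*n (suc c)) _) ⟩
    ∑ c f′ + f (suc c *ℕ d)  ≡⟨ cong (_+_ (∑ c f′)) (f-cong (ℕ.*-comm (suc c) d)) ⟩
    ∑ (suc c) f′             ≡⟨ cong (λ q → ∑ q f′) (m*n/n≡m (suc c) d) ⟨
    ∑ (suc c *ℕ d / d) f′    ∎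
    where
    -- Plain `cong` does not apply, since the type of the instance argument depends on the index.
    f-cong : ∀ {i j} .{{_ : NonZero i}} .{{_ : NonZero j}} → i ≡ j → f i ≡ f j
    f-cong refl = refl

-- The Möbius function

primeFactors : (n : ℕ) .{{_ : NonZero n}} → List ℕ
primeFactors n = factors (factorise n)

-- A second factorisation of the product, to be compared with the one computed by `factorise`;
-- uniqueness of factorisation relates the two lists up to permutation.
_⊗_ : ∀ {m n} → PrimeFactorisation m → PrimeFactorisation n → PrimeFactorisation (m *ℕ n)
x ⊗ y = record
  { factors         = factors x ++ factors y
  ; isFactorisation = trans (cong₂ _*ℕ_ (isFactorisation x) (isFactorisation y)) (sym (product-++ (factors x) (factors y)))
  ; factorsPrime    = ++⁺ (factorsPrime x) (factorsPrime y)
  }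

primeFactors-* : ∀ m n .{{_ : NonZero m}} .{{_ : NonZero n}} .{{_ : NonZero (m *ℕ n)}} →
  primeFactors (m *ℕ n) ↭ primeFactors m ++ primeFactors n
primeFactors-* m n = factorisationUnique (factorise (m *ℕ n)) (factorise m ⊗ factorise n)

primeFactors-prime-* : ∀ {q} → Prime q → ∀ n .{{_ : NonZero n}} .{{_ : NonZero (q *ℕ n)}} →
  primeFactors (q *ℕ n) ↭ q ∷ primeFactors n
primeFactors-prime-* {q} q-prime n = factorisationUnique (factorise (q *ℕ n)) (primeFactorisation[p] q-prime ⊗ factorise n)

∈primeFactors⇒∣ : ∀ {q} n .{{_ : NonZero n}} → q ∈ primeFactors n → q ∣ n
∈primeFactors⇒∣ n q∈ = subst (_ ∣_) (sym (isFactorisation (factorise n))) (∈⇒∣product q∈)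

∣⇒∈primeFactors : ∀ {q} → Prime q → ∀ n .{{_ : NonZero n}} → q ∣ n → q ∈ primeFactors n
∣⇒∈primeFactors q-prime n q∣n =
  factorisationHasAllPrimeFactors q-prime (subst (_ ∣_) (isFactorisation (factorise n)) q∣n) (factorsPrime (factorise n))

primeDivisor : ∀ n .{{_ : NonZero n}} → n ≢ 1 → ∃ λ q → Prime q × q ∣ n
primeDivisor n n≢1 = go (factorise n)
  where
  go : PrimeFactorisation n → ∃ λ q → Prime q × q ∣ n
  go record { factors = []     ; isFactorisation = n≡1 } = contradiction n≡1 n≢1
  go record { factors = q ∷ qs ; isFactorisation = refl ; factorsPrime = q-prime ∷ _ } = q , q-prime , m∣m*n (product qs)

-- `μ n` unfolds to this function at `primeFactors n`. Isolating the list allows it to be replaced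
-- by a permutation of itself.
μ-list : List ℕ → ℤ
μ-list ps = if does (unique? ℕ._≟_ ps) then ℤ.-1ℤ ℤ.^ length ps else + 0

μ-list-↭ : ∀ {ps qs} → ps ↭ qs → μ-list ps ≡ μ-list qs
μ-list-↭ {ps} {qs} ps↭qs = cong₂ (λ b l → if b then ℤ.-1ℤ ℤ.^ l else + 0)
  (does-⇔ (mk⇔ (Unique-resp ps↭qs) (Unique-resp (↭-sym ps↭qs))) (unique? ℕ._≟_ ps) (unique? ℕ._≟_ qs))
  (↭-length ps↭qs)
  where
  Unique-resp : ∀ {xs ys : List ℕ} → xs ↭ ys → Unique xs → Unique ys
  Unique-resp xs↭ys = Permutationₛ.Unique-resp-↭ (setoid ℕ) (↭⇒↭ₛ xs↭ys)

μ-list-unique : ∀ ps → Unique ps → μ-list ps ≡ ℤ.-1ℤ ℤ.^ length ps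
μ-list-unique ps ps! = cong (if_then ℤ.-1ℤ ℤ.^ length ps else + 0) (dec-true (unique? ℕ._≟_ ps) ps!)

μ-list-¬unique : ∀ ps → ¬ Unique ps → μ-list ps ≡ + 0
μ-list-¬unique ps ¬ps! = cong (if_then ℤ.-1ℤ ℤ.^ length ps else + 0) (dec-false (unique? ℕ._≟_ ps) ¬ps!)

μ-list-∈ : ∀ {q ps} → q ∈ ps → μ-list (q ∷ ps) ≡ + 0
μ-list-∈ {q} {ps} q∈ps = μ-list-¬unique (q ∷ ps) λ { (q≢ps ∷ _) → All¬⇒¬Any q≢ps q∈ps }

μ-list-∉ : ∀ {q ps} → q ∉ ps → μ-list (q ∷ ps) ≡ - μ-list ps
μ-list-∉ {q} {ps} q∉ps = go (unique? ℕ._≟_ ps)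
  where
  go : Dec (Unique ps) → μ-list (q ∷ ps) ≡ - μ-list ps
  go (yes ps!) = trans (μ-list-unique (q ∷ ps) (¬Any⇒All¬ ps q∉ps ∷ ps!))
                       (trans (ℤ.-1*i≡-i (ℤ.-1ℤ ℤ.^ length ps)) (cong -_ (sym (μ-list-unique ps ps!))))
  go (no ¬ps!) = trans (μ-list-¬unique (q ∷ ps) λ { (_ ∷ ps!) → ¬ps! ps! }) (cong -_ (sym (μ-list-¬unique ps ¬ps!)))

module _ {q : ℕ} (q-prime : Prime q) where

  private instance
    q≢0 : NonZero q
    q≢0 = prime⇒nonZero q-prime

  μ-*-∣ : ∀ n .{{_ : NonZero n}} .{{_ : NonZero (q *ℕ n)}} → q ∣ n → μ (q *ℕ n) ≡ + 0
  μ-*-∣ n q∣n = trans (μ-list-↭ (primeFactors-prime-* q-prime n)) (μ-list-∈ (∣⇒∈primeFactors q-prime n q∣n))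

  μ-*-∤ : ∀ n .{{_ : NonZero n}} .{{_ : NonZero (q *ℕ n)}} → q ∤ n → μ (q *ℕ n) ≡ - μ n
  μ-*-∤ n q∤n = trans (μ-list-↭ (primeFactors-prime-* q-prime n)) (μ-list-∉ (q∤n ∘ ∈primeFactors⇒∣ n))

  -- With g = c d, Euclid's lemma forces q to divide the cofactor c.
  *-∣ : ∀ {d g} → q ∤ d → q ∣ g → d ∣ g → q *ℕ d ∣ g
  *-∣ {d} q∤d q∣g (divides c refl) with euclidsLemma c d q-prime q∣g
  ... | inj₁ q∣c = *-monoˡ-∣ d q∣c
  ... | inj₂ q∣d = contradiction q∣d q∤d

  -- The divisors d of g with q ∤ d are paired with the divisors q d, on which μ
  -- takes the opposite value; μ vanishes on the remaining divisors.
  ∑-μ-divisors-pairing : ∀ {n g} .{{_ : NonZero g}} → g ≤ n → q ∣ g → ∑ n (λ d → 𝟙 (d ∣? g) * μ d) ≡ + 0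
  ∑-μ-divisors-pairing {n} {g} g≤n q∣g = begin
    ∑ n μ∣g                                                ≡⟨ ∑-cong n (λ d _ → split d (q ∣? d)) ⟩
    ∑ n (λ d → 𝟙 (q ∣? d) * μ∣g d + coprimePart d)         ≡⟨ ∑-+ n (λ d → 𝟙 (q ∣? d) * μ∣g d) coprimePart ⟩
    ∑ n (λ d → 𝟙 (q ∣? d) * μ∣g d) + ∑ n coprimePart       ≡⟨ cong₂ _+_ (∑-multiples q n μ∣g)
                                                                (∑-truncate n coprimePart (m/n≤m n q) λ d n/q<d _ → vanish d n/q<d (q ∣? d)) ⟩
    ∑ (n / q) (at-multiples q μ∣g) + ∑ (n / q) coprimePart ≡⟨ cong (_+ ∑ (n / q) coprimePart) (∑-cong (n / q) λ d _ → opposite d (q ∣? d)) ⟩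
    ∑ (n / q) (λ d → - coprimePart d) + ∑ (n / q) coprimePart ≡⟨ cong (_+ ∑ (n / q) coprimePart) (∑-neg (n / q) coprimePart) ⟩
    - ∑ (n / q) coprimePart + ∑ (n / q) coprimePart        ≡⟨ ℤ.+-inverseˡ (∑ (n / q) coprimePart) ⟩
    + 0                                                    ∎
    where
    open ≡-Reasoning

    μ∣g coprimePart : Summand
    μ∣g d = 𝟙 (d ∣? g) * μ d
    -- The factor in front is the indicator of q ∤ d.
    coprimePart d = (+ 1 - 𝟙 (q ∣? d)) * μ∣g d

    coprimePart-∣ : ∀ d .{{_ : NonZero d}} → q ∣ d → coprimePart d ≡ + 0
    coprimePart-∣ d q∣d = cong (λ i → (+ 1 - i) * μ∣g d) (𝟙-true (q ∣? d) q∣d)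

    coprimePart-∤ : ∀ d .{{_ : NonZero d}} → q ∤ d → coprimePart d ≡ μ∣g d
    coprimePart-∤ d q∤d = trans (cong (λ i → (+ 1 - i) * μ∣g d) (𝟙-false (q ∣? d) q∤d)) (ℤ.*-identityˡ (μ∣g d))

    split : ∀ d .{{_ : NonZero d}} → Dec (q ∣ d) → μ∣g d ≡ 𝟙 (q ∣? d) * μ∣g d + coprimePart d
    split d (yes q∣d) = sym (trans (cong₂ _+_ (𝟙*-true (q ∣? d) q∣d (μ∣g d)) (coprimePart-∣ d q∣d)) (ℤ.+-identityʳ (μ∣g d)))
    split d (no q∤d)  = sym (trans (cong₂ _+_ (𝟙*-false (q ∣? d) q∤d (μ∣g d)) (coprimePart-∤ d q∤d)) (ℤ.+-identityˡ (μ∣g d)))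

    -- A divisor d of g with q ∤ d satisfies q d ∣ g, hence q d ≤ n and d ≤ n / q. This cuts the sum
    -- to the range that reindexing by multiples of q produces.
    vanish : ∀ d .{{_ : NonZero d}} → n / q < d → Dec (q ∣ d) → coprimePart d ≡ + 0
    vanish d n/q<d (yes q∣d) = coprimePart-∣ d q∣d
    vanish d n/q<d (no q∤d)  = trans (coprimePart-∤ d q∤d) (𝟙*-false (d ∣? g) d∤g (μ d))
      where
      d∤g : d ∤ g
      d∤g d∣g = ℕ.<⇒≱ n/q<d (subst (_≤ n / q) (m*n/n≡m d q)
                  (/-monoˡ-≤ q (subst (_≤ n) (ℕ.*-comm q d) (ℕ.≤-trans (∣⇒≤ (*-∣ q∤d q∣g d∣g)) g≤n))))

    opposite : ∀ d .{{_ : NonZero d}} → Dec (q ∣ d) → at-multiples q μ∣g d ≡ - coprimePart d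
    opposite d (yes q∣d) = begin
      𝟙 (q *ℕ d ∣? g) * μ (q *ℕ d)  ≡⟨ cong (𝟙 (q *ℕ d ∣? g) *_) (μ-*-∣ d q∣d) ⟩
      𝟙 (q *ℕ d ∣? g) * + 0         ≡⟨ ℤ.*-zeroʳ (𝟙 (q *ℕ d ∣? g)) ⟩
      - + 0                         ≡⟨ cong -_ (coprimePart-∣ d q∣d) ⟨
      - coprimePart d               ∎
      where
      instance _ = ℕ.m*n≢0 q d
    opposite d (no q∤d) = begin
      𝟙 (q *ℕ d ∣? g) * μ (q *ℕ d)  ≡⟨ cong₂ _*_ (𝟙-⇔ (q *ℕ d ∣? g) (d ∣? g) (∣-trans (n∣m*n q)) (*-∣ q∤d q∣g)) (μ-*-∤ d q∤d) ⟩
      𝟙 (d ∣? g) * - μ d            ≡⟨ ℤ.neg-distribʳ-* (𝟙 (d ∣? g)) (μ d) ⟨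
      - μ∣g d                       ≡⟨ cong -_ (coprimePart-∤ d q∤d) ⟨
      - coprimePart d               ∎
      where
      instance _ = ℕ.m*n≢0 q d

-- A prime divisor of g ≠ 1 makes the terms cancel; for g = 1 only d = 1 survives. Any range n ≥ g
-- is allowed, so that a single range serves all g at once when sums are interchanged.
∑-μ-divisors : ∀ {n} g .{{_ : NonZero g}} → g ≤ n → ∑ n (λ d → 𝟙 (d ∣? g) * μ d) ≡ 𝟙 (g ℕ.≟ 1)
∑-μ-divisors {n} g g≤n = go (g ℕ.≟ 1)
  where
  go : Dec (g ≡ 1) → ∑ n (λ d → 𝟙 (d ∣? g) * μ d) ≡ 𝟙 (g ℕ.≟ 1)
  go (no g≢1) = let q , q-prime , q∣g = primeDivisor g g≢1 in
    trans (∑-μ-divisors-pairing q-prime g≤n q∣g) (sym (𝟙-false (g ℕ.≟ 1) g≢1))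
  go (yes refl) = ∑-truncate n (λ d → 𝟙 (d ∣? 1) * μ d) g≤n
    λ d 1<d _ → 𝟙*-false (d ∣? 1) (λ d∣1 → ℕ.<⇒≢ 1<d (sym (∣1⇒≡1 d∣1))) (μ d)

-- Pairs h ≤ k ≤ n

∑ₗ-indices : ∀ n (c : (h : ℕ) .{{_ : NonZero h}} → Summand) →
  ∑ₗ (map (λ (i , j) → c (suc i) (suc j)) (indices n)) ≡ ∑ n (λ k → ∑ k (λ h → c h k))
∑ₗ-indices n c = begin
  ∑ₗ (map c⁺ (indices n))
    ≡⟨ ∑ₗ-concatMap c⁺ (λ j → map (_, j) (upTo (suc j))) (upTo n) ⟩
  ∑ₗ (map (λ j → ∑ₗ (map c⁺ (map (_, j) (upTo (suc j))))) (upTo n))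
    ≡⟨ cong ∑ₗ (map-cong (λ j → cong ∑ₗ (map-∘ {g = c⁺} {f = _, j} (upTo (suc j)))) (upTo n)) ⟨
  ∑₁ n (λ k → ∑₁ k (λ h → c h k))
    ≡⟨ ∑₁≡∑ n (λ k → ∑₁ k (λ h → c h k)) ⟩
  ∑ n (λ k → ∑₁ k (λ h → c h k))
    ≡⟨ ∑-cong n (λ k _ → ∑₁≡∑ k (λ h → c h k)) ⟩
  ∑ n (λ k → ∑ k (λ h → c h k))
    ∎
  where
  open ≡-Reasoning
  c⁺ : ℕ × ℕ → ℤ
  c⁺ (i , j) = c (suc i) (suc j)

𝟙-∣gcd : ∀ d h k → 𝟙 (d ∣? gcd h k) ≡ 𝟙 (d ∣? k) * 𝟙 (d ∣? h)
𝟙-∣gcd d h k = go (d ∣? k) (d ∣? h)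
  where
  go : Dec (d ∣ k) → Dec (d ∣ h) → 𝟙 (d ∣? gcd h k) ≡ 𝟙 (d ∣? k) * 𝟙 (d ∣? h)
  go (yes d∣k) (yes d∣h) = trans (𝟙-true (d ∣? gcd h k) (gcd-greatest d∣h d∣k))
    (sym (cong₂ _*_ (𝟙-true (d ∣? k) d∣k) (𝟙-true (d ∣? h) d∣h)))
  go (yes d∣k) (no d∤h)  = trans (𝟙-false (d ∣? gcd h k) λ d∣g → d∤h (∣-trans d∣g (gcd[m,n]∣m h k)))
    (sym (cong₂ _*_ (𝟙-true (d ∣? k) d∣k) (𝟙-false (d ∣? h) d∤h)))
  go (no d∤k)  _         = trans (𝟙-false (d ∣? gcd h k) λ d∣g → d∤k (∣-trans d∣g (gcd[m,n]∣n h k)))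
    (sym (𝟙*-false (d ∣? k) d∤k (𝟙 (d ∣? h))))

-- Möbius inversion for sums of a weight that depends only on the fraction h / k.
∑-coprime-pairs : ∀ n (c : (h : ℕ) .{{_ : NonZero h}} → Summand) →
  (∀ d h k .{{_ : NonZero d}} .{{_ : NonZero h}} .{{_ : NonZero k}} →
    c (d *ℕ h) {{ℕ.m*n≢0 d h}} (d *ℕ k) {{ℕ.m*n≢0 d k}} ≡ c h k) →
  ∑ n (λ k → ∑ k (λ h → 𝟙 (gcd h k ℕ.≟ 1) * c h k)) ≡ ∑ n (λ d → μ d * ∑ (n / d) (λ k → ∑ k (λ h → c h k)))
∑-coprime-pairs n c c-scale = begin
  ∑ n (λ k → ∑ k (λ h → 𝟙 (gcd h k ℕ.≟ 1) * c h k))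
    ≡⟨ ∑-cong n (λ k k≤n → ∑-cong k (λ h _ → expand h k k≤n)) ⟩
  ∑ n (λ k → ∑ k (λ h → ∑ n (λ d → term d h k)))
    ≡⟨ ∑-cong n (λ k _ → ∑-comm k n (λ h d → term d h k)) ⟩
  ∑ n (λ k → ∑ n (λ d → ∑ k (λ h → term d h k)))
    ≡⟨ ∑-comm n n (λ k d → ∑ k (λ h → term d h k)) ⟩
  ∑ n (λ d → ∑ n (λ k → ∑ k (λ h → term d h k)))
    ≡⟨ ∑-cong n (λ d _ → collect d) ⟩
  ∑ n (λ d → μ d * ∑ (n / d) (λ k → ∑ k (λ h → c h k)))
    ∎
  where
  open ≡-Reasoning

  term : (d h k : ℕ) .{{_ : NonZero d}} .{{_ : NonZero h}} .{{_ : NonZero k}} → ℤ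
  term d h k = μ d * (𝟙 (d ∣? k) * (𝟙 (d ∣? h) * c h k))

  rearrange : ∀ i j k l → i * j * k * l ≡ k * (i * (j * l))
  rearrange = solve-∀

  expand : ∀ h k .{{_ : NonZero h}} .{{_ : NonZero k}} → k ≤ n → 𝟙 (gcd h k ℕ.≟ 1) * c h k ≡ ∑ n (λ d → term d h k)
  expand h k k≤n = begin
    𝟙 (gcd h k ℕ.≟ 1) * c h k
      ≡⟨ cong (_* c h k) (∑-μ-divisors (gcd h k) (ℕ.≤-trans (gcd[m,n]≤n h k) k≤n)) ⟨
    ∑ n (λ d → 𝟙 (d ∣? gcd h k) * μ d) * c h k
      ≡⟨ ∑-*ʳ n (c h k) (λ d → 𝟙 (d ∣? gcd h k) * μ d) ⟨
    ∑ n (λ d → 𝟙 (d ∣? gcd h k) * μ d * c h k)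
      ≡⟨ ∑-cong n (λ d _ → trans (cong (λ i → i * μ d * c h k) (𝟙-∣gcd d h k))
                                  (rearrange (𝟙 (d ∣? k)) (𝟙 (d ∣? h)) (μ d) (c h k))) ⟩
    ∑ n (λ d → term d h k)
      ∎
    where
    instance _ = ℕ.≢-nonZero (gcd[m,n]≢0 h k (inj₂ (ℕ.≢-nonZero⁻¹ k)))

  row : ∀ d .{{_ : NonZero d}} → Summand
  row d k = ∑ k (λ h → 𝟙 (d ∣? h) * c h k)

  -- In row d k the multiples of d are the d h with h ≤ k, and scale invariance removes d from both
  -- arguments of `c`.
  row-multiple : ∀ d k .{{_ : NonZero d}} .{{_ : NonZero k}} → at-multiples d (row d) k ≡ ∑ k (λ h → c h k)
  row-multiple d k = begin
    ∑ (d *ℕ k) (λ h → 𝟙 (d ∣? h) * c h (d *ℕ k))             ≡⟨ ∑-multiples d (d *ℕ k) (λ h → c h (d *ℕ k)) ⟩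
    ∑ (d *ℕ k / d) (at-multiples d (λ h → c h (d *ℕ k)))     ≡⟨ ∑-cong (d *ℕ k / d) (λ h _ → c-scale d h k) ⟩
    ∑ (d *ℕ k / d) (λ h → c h k)                             ≡⟨ cong (λ m → ∑ m (λ h → c h k)) (trans (cong (_/ d) (ℕ.*-comm d k)) (m*n/n≡m k d)) ⟩
    ∑ k (λ h → c h k)                                        ∎
    where
    instance _ = ℕ.m*n≢0 d k

  collect : ∀ d .{{_ : NonZero d}} → ∑ n (λ k → ∑ k (λ h → term d h k)) ≡ μ d * ∑ (n / d) (λ k → ∑ k (λ h → c h k))
  collect d = begin
    ∑ n (λ k → ∑ k (λ h → term d h k))
      ≡⟨ ∑-cong n (λ k _ → trans (∑-*ˡ k (μ d) (λ h → 𝟙 (d ∣? k) * (𝟙 (d ∣? h) * c h k)))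
                                  (cong (μ d *_) (∑-*ˡ k (𝟙 (d ∣? k)) (λ h → 𝟙 (d ∣? h) * c h k)))) ⟩
    ∑ n (λ k → μ d * (𝟙 (d ∣? k) * row d k))
      ≡⟨ ∑-*ˡ n (μ d) (λ k → 𝟙 (d ∣? k) * row d k) ⟩
    μ d * ∑ n (λ k → 𝟙 (d ∣? k) * row d k)
      ≡⟨ cong (μ d *_) (∑-multiples d n (row d)) ⟩
    μ d * ∑ (n / d) (at-multiples d (row d))
      ≡⟨ cong (μ d *_) (∑-cong (n / d) (λ k _ → row-multiple d k)) ⟩
    μ d * ∑ (n / d) (λ k → ∑ k (λ h → c h k))
      ∎

-- ⌊n/k⌋ counts the multiples j ≤ n of k. After interchanging the sums, the inner one runs over the
-- divisors k of j and vanishes unless j = 1.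
∑-μ-floor : ∀ n .{{_ : NonZero n}} → ∑ n (λ k → μ k * + (n / k)) ≡ + 1
∑-μ-floor n = begin
  ∑ n (λ k → μ k * + (n / k))                        ≡⟨ ∑-cong n (λ k _ → cong (μ k *_) (sym (trans (∑-multiples k n (λ _ → + 1)) (trans (∑-const (n / k) (+ 1)) (ℤ.*-identityʳ (+ (n / k))))))) ⟩
  ∑ n (λ k → μ k * ∑ n (λ j → 𝟙 (k ∣? j) * + 1))     ≡⟨ ∑-cong n (λ k _ → sym (∑-*ˡ n (μ k) (λ j → 𝟙 (k ∣? j) * + 1))) ⟩
  ∑ n (λ k → ∑ n (λ j → μ k * (𝟙 (k ∣? j) * + 1)))   ≡⟨ ∑-comm n n (λ k j → μ k * (𝟙 (k ∣? j) * + 1)) ⟩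
  ∑ n (λ j → ∑ n (λ k → μ k * (𝟙 (k ∣? j) * + 1)))   ≡⟨ ∑-cong n (λ j j≤n → trans (∑-cong n (λ k _ → rearrange (μ k) (𝟙 (k ∣? j)))) (∑-μ-divisors j j≤n)) ⟩
  ∑ n (λ j → 𝟙 (j ℕ.≟ 1))                            ≡⟨ ∑-truncate n (λ j → 𝟙 (j ℕ.≟ 1)) (ℕ.>-nonZero⁻¹ n) (λ j 1<j _ → 𝟙-false (j ℕ.≟ 1) (ℕ.>⇒≢ 1<j)) ⟩
  + 1                                                ∎
  where
  open ≡-Reasoning
  rearrange : ∀ i j → i * (j * + 1) ≡ j * i
  rearrange = solve-∀

-- Orders of products of fractions

ordℕ-cong : ∀ p {m n} .{{_ : NonZero m}} .{{_ : NonZero n}} → m ≡ n → ordℕ p m ≡ ordℕ p n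
ordℕ-cong p refl = refl

module _ (p : ℕ) where

  ordℕ-* : ∀ m n .{{_ : NonZero m}} .{{_ : NonZero n}} .{{_ : NonZero (m *ℕ n)}} → ordℕ p (m *ℕ n) ≡ ordℕ p m +ℕ ordℕ p n
  ordℕ-* m n = begin
    length (filter (p ℕ.≟_) (primeFactors (m *ℕ n)))
      ≡⟨ ↭-length (filter-↭ (p ℕ.≟_) (primeFactors-* m n)) ⟩
    length (filter (p ℕ.≟_) (primeFactors m ++ primeFactors n))
      ≡⟨ cong length (filter-++ (p ℕ.≟_) (primeFactors m) (primeFactors n)) ⟩
    length (filter (p ℕ.≟_) (primeFactors m) ++ filter (p ℕ.≟_) (primeFactors n))
      ≡⟨ length-++ (filter (p ℕ.≟_) (primeFactors m)) ⟩
    ordℕ p m +ℕ ordℕ p n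
      ∎
    where open ≡-Reasoning

  -- The hypothesis is m / l = k / n after cross-multiplication, so this says that the order of a
  -- fraction does not depend on its representative. It serves both for reduction to lowest terms
  -- and for scale invariance.
  cross-difference : ∀ m n k l .{{_ : NonZero m}} .{{_ : NonZero n}} .{{_ : NonZero k}} .{{_ : NonZero l}} →
    m *ℕ n ≡ k *ℕ l → + ordℕ p m - + ordℕ p l ≡ + ordℕ p k - + ordℕ p n
  cross-difference m n k l mn≡kl = begin
    + ordℕ p m - + ordℕ p l                            ≡⟨ extend (+ ordℕ p m) (+ ordℕ p l) (+ ordℕ p n) ⟩
    + (ordℕ p m +ℕ ordℕ p n) - (+ ordℕ p l + + ordℕ p n)  ≡⟨ cong (λ i → + i - (+ ordℕ p l + + ordℕ p n)) ord-mn≡ord-kl ⟩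
    + (ordℕ p k +ℕ ordℕ p l) - (+ ordℕ p l + + ordℕ p n)  ≡⟨ cancel (+ ordℕ p k) (+ ordℕ p l) (+ ordℕ p n) ⟩
    + ordℕ p k - + ordℕ p n                            ∎
    where
    open ≡-Reasoning
    extend : ∀ x y z → x - y ≡ x + z - (y + z)
    extend = solve-∀
    cancel : ∀ x y z → x + y - (y + z) ≡ x - z
    cancel = solve-∀
    instance
      mn≢0 : NonZero (m *ℕ n)
      mn≢0 = ℕ.m*n≢0 m n
      kl≢0 : NonZero (k *ℕ l)
      kl≢0 = ℕ.m*n≢0 k l
    ord-mn≡ord-kl : ordℕ p m +ℕ ordℕ p n ≡ ordℕ p k +ℕ ordℕ p l
    ord-mn≡ord-kl = trans (sym (ordℕ-* m n)) (trans (ordℕ-cong p mn≡kl) (ordℕ-* k l))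

  -- The order read off a fraction that need not be reduced: products in `ℚᵘ` multiply numerators
  -- and denominators without cancellation.
  ordᵘ : (x : ℚᵘ) .{{_ : ℚᵘ.NonZero x}} → ℤ
  ordᵘ x@record{} = + ordℕ p ℤ.∣ ↥ x ∣ - + ordℕ p (↧ₙ x)

  ord-toℚᵘ : ∀ x (y : ℚᵘ) .{{_ : ℚ.NonZero x}} .{{_ : ℚᵘ.NonZero y}} → toℚᵘ x ℚᵘ.≃ y → ord p x ≡ ordᵘ y
  ord-toℚᵘ (mkℚ m d _) (mkℚᵘ n e) (*≡* me≡nd) = cross-difference ℤ.∣ m ∣ (suc e) ℤ.∣ n ∣ (suc d)
    (trans (sym (ℤ.abs-* m (+ suc e))) (trans (cong ℤ.∣_∣ me≡nd) (ℤ.abs-* n (+ suc d))))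

  -- Positivity exposes the numerators as successors, so that the absolute value of the unreduced
  -- numerator computes to a product of naturals.
  ord-* : ∀ x y .{{_ : ℚ.Positive x}} .{{_ : ℚ.Positive y}} .{{_ : ℚ.NonZero x}} .{{_ : ℚ.NonZero y}} .{{_ : ℚ.NonZero (x ℚ.* y)}} →
    ord p (x ℚ.* y) ≡ ord p x + ord p y
  ord-* x@(mkℚ +[1+ m ] d _) y@(mkℚ +[1+ n ] e _) = begin
    ord p (x ℚ.* y)                                    ≡⟨ ord-toℚᵘ (x ℚ.* y) (toℚᵘ x ℚᵘ.* toℚᵘ y) (toℚᵘ-homo-* x y) ⟩
    + ordℕ p (suc m *ℕ suc n) - + ordℕ p (suc d *ℕ suc e) ≡⟨ cong₂ (λ i j → + i - + j) (ordℕ-* (suc m) (suc n)) (ordℕ-* (suc d) (suc e)) ⟩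
    + ordℕ p (suc m) + + ordℕ p (suc n) - (+ ordℕ p (suc d) + + ordℕ p (suc e))
      ≡⟨ regroup (+ ordℕ p (suc m)) (+ ordℕ p (suc n)) (+ ordℕ p (suc d)) (+ ordℕ p (suc e)) ⟩
    ord p x + ord p y                                  ∎
    where
    open ≡-Reasoning
    regroup : ∀ i j k l → i + j - (k + l) ≡ i - k + (j - l)
    regroup = solve-∀

  ord-1/ : ∀ x .{{_ : ℚ.Positive x}} .{{_ : ℚ.NonZero x}} .{{_ : ℚ.NonZero (1/ x)}} → ord p (1/ x) ≡ - ord p x
  ord-1/ (mkℚ +[1+ m ] d _) = negate (+ ordℕ p (suc d)) (+ ordℕ p (suc m))
    where
    negate : ∀ i j → i - j ≡ - (j - i)
    negate = solve-∀

  -- The order of k / h, the reciprocal of the fraction h / k; this sign fits `F̅` and `G̅`, which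
  -- are reciprocals of products.
  ord-gap : (h : ℕ) .{{_ : NonZero h}} → Summand
  ord-gap h k = + ordℕ p k - + ordℕ p h

  ord-gap-scale : ∀ d h k .{{_ : NonZero d}} .{{_ : NonZero h}} .{{_ : NonZero k}} →
    ord-gap (d *ℕ h) {{ℕ.m*n≢0 d h}} (d *ℕ k) {{ℕ.m*n≢0 d k}} ≡ ord-gap h k
  ord-gap-scale d h k = cross-difference (d *ℕ k) h k (d *ℕ h) (rearrange d k h)
    where
    instance
      dh≢0 : NonZero (d *ℕ h)
      dh≢0 = ℕ.m*n≢0 d h
      dk≢0 : NonZero (d *ℕ k)
      dk≢0 = ℕ.m*n≢0 d k
    rearrange : ∀ i j l → i *ℕ j *ℕ l ≡ j *ℕ (i *ℕ l)
    rearrange = solve-∀ℕ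

  gap : ℕ × ℕ → ℤ
  gap (i , j) = ord-gap (suc i) (suc j)

  ord-∏fractions : ∀ ijs .{{_ : ℚ.NonZero (∏fractions ijs)}} → ord p (∏fractions ijs) ≡ - ∑ₗ (map gap ijs)
  ord-∏fractions []             = refl
  ord-∏fractions ((i , j) ∷ ijs) = begin
    ord p (fraction (i , j) ℚ.* ∏fractions ijs)      ≡⟨ ord-* (fraction (i , j)) (∏fractions ijs) ⟩
    ord p (fraction (i , j)) + ord p (∏fractions ijs) ≡⟨ cong₂ _+_ (ord-toℚᵘ (fraction (i , j)) (mkℚᵘ (+ suc i) j) (toℚᵘ-fromℚᵘ (mkℚᵘ (+ suc i) j))) (ord-∏fractions ijs) ⟩
    + ordℕ p (suc i) - + ordℕ p (suc j) - ∑ₗ (map gap ijs) ≡⟨ regroup (+ ordℕ p (suc i)) (+ ordℕ p (suc j)) (∑ₗ (map gap ijs)) ⟩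
    - (gap (i , j) + ∑ₗ (map gap ijs))               ∎
    where
    open ≡-Reasoning
    regroup : ∀ x y z → x - y - z ≡ - (y - x + z)
    regroup = solve-∀
    instance
      fraction-pos : ℚ.Positive (fraction (i , j))
      fraction-pos = normalize-pos (suc i) (suc j)
      ∏-pos : ℚ.Positive (∏fractions ijs)
      ∏-pos = ∏fractions-pos ijs
      fraction-nonZero : ℚ.NonZero (fraction (i , j))
      fraction-nonZero = pos⇒nonZero (fraction (i , j))
      ∏-nonZero : ℚ.NonZero (∏fractions ijs)
      ∏-nonZero = pos⇒nonZero (∏fractions ijs)

  ord-1/∏fractions : ∀ ijs .{{_ : ℚ.NonZero (1/∏fractions ijs)}} → ord p (1/∏fractions ijs) ≡ ∑ₗ (map gap ijs)
  ord-1/∏fractions ijs = begin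
    ord p (1/ ∏fractions ijs)    ≡⟨ ord-1/ (∏fractions ijs) ⟩
    - ord p (∏fractions ijs)     ≡⟨ cong -_ (ord-∏fractions ijs) ⟩
    - - ∑ₗ (map gap ijs)         ≡⟨ ℤ.neg-involutive (∑ₗ (map gap ijs)) ⟩
    ∑ₗ (map gap ijs)             ∎
    where
    open ≡-Reasoning
    instance
      ∏-pos : ℚ.Positive (∏fractions ijs)
      ∏-pos = ∏fractions-pos ijs
      ∏-nonZero : ℚ.NonZero (∏fractions ijs)
      ∏-nonZero = pos⇒nonZero (∏fractions ijs)

  ordG̅≡∑ : ∀ n → ordG̅ p n ≡ ∑ n (λ k → ∑ k (λ h → ord-gap h k))
  ordG̅≡∑ n = trans (ord-1/∏fractions (indices n) {{G̅-nonZero n}}) (∑ₗ-indices n ord-gap)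

  -- The filter on coprime pairs turns into the bracket of gcd = 1, and Möbius inversion applies
  -- because `ord-gap` ignores common factors.
  ordF̅≡∑-ordG̅ : ∀ n → ordF̅ p n ≡ ∑ n (λ d → μ d * ordG̅ p (n / d))
  ordF̅≡∑-ordG̅ n = begin
    ordF̅ p n
      ≡⟨ ord-1/∏fractions (coprimeIndices n) {{F̅-nonZero n}} ⟩
    ∑ₗ (map gap (coprimeIndices n))
      ≡⟨ ∑ₗ-filter (λ (i , j) → gcd (suc i) (suc j) ℕ.≟ 1) gap (indices n) ⟩
    ∑ₗ (map (λ (i , j) → 𝟙 (gcd (suc i) (suc j) ℕ.≟ 1) * gap (i , j)) (indices n))
      ≡⟨ ∑ₗ-indices n (λ h k → 𝟙 (gcd h k ℕ.≟ 1) * ord-gap h k) ⟩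
    ∑ n (λ k → ∑ k (λ h → 𝟙 (gcd h k ℕ.≟ 1) * ord-gap h k))
      ≡⟨ ∑-coprime-pairs n ord-gap ord-gap-scale ⟩
    ∑ n (λ d → μ d * ∑ (n / d) (λ k → ∑ k (λ h → ord-gap h k)))
      ≡⟨ ∑-cong n (λ d _ → cong (μ d *_) (ordG̅≡∑ (n / d))) ⟨
    ∑ n (λ d → μ d * ordG̅ p (n / d))
      ∎
    where open ≡-Reasoning

-- The order of `G̅` at numbers below p²

-- The value v k is added k times, once for each h ≤ k, and subtracted n + 1 - k times, once for
-- each index from k to n.
∑-differences : ∀ n (v : Summand) → ∑ n (λ k → ∑ k (λ h → v k - v h)) ≡ ∑ n (λ k → v k * (+ 2 * + k - + suc n))
∑-differences zero    v = refl
∑-differences (suc n) v = begin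
  ∑ n (λ k → ∑ k (λ h → v k - v h)) + ∑ (suc n) (λ h → last - v h)
    ≡⟨ cong₂ _+_ (∑-differences n v)
                 (trans (∑-- (suc n) (λ _ → last) v) (cong (_- ∑ (suc n) v) (∑-const (suc n) last))) ⟩
  ∑ n (weighted n) + (+ suc n * last - ∑ (suc n) v)
    -- Raising n by one lowers every earlier weight by one, which absorbs `∑ n v`; the new last
    -- weight is 2 (n + 1) - (n + 2) = n.
    ≡⟨ regroup (∑ n (weighted n)) (+ n) last (∑ n v) ⟩
  ∑ n (weighted n) - ∑ n v + weighted (suc n) (suc n)
    ≡⟨ cong (_+ weighted (suc n) (suc n)) (∑-- n (weighted n) v) ⟨
  ∑ n (λ k → weighted n k - v k) + weighted (suc n) (suc n)
    ≡⟨ cong (_+ weighted (suc n) (suc n)) (∑-cong n (λ k _ → shift (v k) (+ k) (+ n))) ⟩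
  ∑ (suc n) (weighted (suc n))
    ∎
  where
  open ≡-Reasoning
  last : ℤ
  last = v (suc n)
  weighted : ℕ → Summand
  weighted m k = v k * (+ 2 * + k - + suc m)
  regroup : ∀ s x y t → s + ((+ 1 + x) * y - (t + y)) ≡ s - t + y * (+ 2 * (+ 1 + x) - (+ 1 + (+ 1 + x)))
  regroup = solve-∀
  shift : ∀ i x y → i * (+ 2 * x - (+ 1 + y)) - i ≡ i * (+ 2 * x - (+ 1 + (+ 1 + y)))
  shift = solve-∀

-- An arithmetic progression; the factor 2 cancels the denominator of the triangular number m (m +
-- 1) / 2.
∑-arithmetic : ∀ m p c → ∑ m (λ j → + 2 * + (p *ℕ j) - c) ≡ + m * (+ p * (+ m + + 1) - c)
∑-arithmetic zero    p c = refl
∑-arithmetic (suc m) p c = begin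
  ∑ m (λ j → + 2 * + (p *ℕ j) - c) + (+ 2 * + (p *ℕ suc m) - c)
    ≡⟨ cong₂ _+_ (∑-arithmetic m p c) (cong (λ i → + 2 * i - c) (ℤ.pos-* p (suc m))) ⟩
  + m * (+ p * (+ m + + 1) - c) + (+ 2 * (+ p * + suc m) - c)
    ≡⟨ expand (+ m) (+ p) c ⟩
  + suc m * (+ p * (+ suc m + + 1) - c)
    ∎
  where
  open ≡-Reasoning
  expand : ∀ x y c → x * (y * (x + + 1) - c) + (+ 2 * (y * (+ 1 + x)) - c) ≡ (+ 1 + x) * (y * (+ 1 + x + + 1) - c)
  expand = solve-∀

module _ {p : ℕ} (p-prime : Prime p) where

  private instance
    p≢0 : NonZero p
    p≢0 = prime⇒nonZero p-prime

  ordℕ-∤ : ∀ n .{{_ : NonZero n}} → p ∤ n → ordℕ p n ≡ 0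
  ordℕ-∤ n p∤n = cong length (filter-none (p ℕ.≟_) (All.tabulate λ { q∈ refl → p∤n (∈primeFactors⇒∣ n q∈) }))

  ordℕ-prime-* : ∀ n .{{_ : NonZero n}} .{{_ : NonZero (p *ℕ n)}} → ordℕ p (p *ℕ n) ≡ suc (ordℕ p n)
  ordℕ-prime-* n = trans (↭-length (filter-↭ (p ℕ.≟_) (primeFactors-prime-* p-prime n)))
                         (cong length (filter-accept (p ℕ.≟_) refl))

  -- A nonzero multiple c p below p² has 0 < c < p, so p does not divide c and occurs exactly once.
  ordℕ-<p² : ∀ n .{{_ : NonZero n}} → n < p *ℕ p → + ordℕ p n ≡ 𝟙 (p ∣? n)
  ordℕ-<p² n n<p² = go (p ∣? n) n<p²
    where
    go : ∀ {n} .{{_ : NonZero n}} → Dec (p ∣ n) → n < p *ℕ p → + ordℕ p n ≡ 𝟙 (p ∣? n)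
    go {n} (no p∤n) _ = trans (cong +_ (ordℕ-∤ n p∤n)) (sym (𝟙-false (p ∣? n) p∤n))
    go {n} (yes p∣n@(divides c@(suc _) n≡cp)) n<p² = trans (cong +_ ordℕ≡1) (sym (𝟙-true (p ∣? n) p∣n))
      where
      instance _ = ℕ.m*n≢0 p c
      p∤c : p ∤ c
      p∤c p∣c = ℕ.<⇒≱ n<p² (subst (p *ℕ p ≤_) (sym n≡cp) (ℕ.*-monoˡ-≤ p (∣⇒≤ p∣c)))
      ordℕ≡1 : ordℕ p n ≡ 1
      ordℕ≡1 = trans (ordℕ-cong p (trans n≡cp (ℕ.*-comm c p))) (trans (ordℕ-prime-* c) (cong suc (ordℕ-∤ c p∤c)))
    go {n} (yes (divides zero refl)) _ = contradiction refl (ℕ.≢-nonZero⁻¹ n)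

  -- Only k = p j with j ≤ a contribute, each with order 1 and weight 2 p j - (n + 1). Their sum is
  -- a (p (a + 1) - (n + 1)), and n = a p + b simplifies the bracket to p - 1 - b.
  ordG̅-digits : ∀ {n} a b → n < p *ℕ p → b < p → n ≡ a *ℕ p +ℕ b → ordG̅ p n ≡ + a * (+ p - + 1 - + b)
  ordG̅-digits {n} a b n<p² b<p n≡ap+b = begin
    ordG̅ p n
      ≡⟨ ordG̅≡∑ p n ⟩
    ∑ n (λ k → ∑ k (λ h → + ordℕ p k - + ordℕ p h))
      ≡⟨ ∑-differences n (λ k → + ordℕ p k) ⟩
    ∑ n (λ k → + ordℕ p k * weight k)
      ≡⟨ ∑-cong n (λ k k≤n → cong (_* weight k) (ordℕ-<p² k (ℕ.≤-<-trans k≤n n<p²))) ⟩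
    ∑ n (λ k → 𝟙 (p ∣? k) * weight k)
      ≡⟨ ∑-multiples p n (λ k → weight k) ⟩
    ∑ (n / p) (λ j → weight (p *ℕ j))
      ≡⟨ ∑-arithmetic (n / p) p (+ suc n) ⟩
    + (n / p) * (+ p * (+ (n / p) + + 1) - + suc n)
      ≡⟨ cong₂ (λ i j → + i * (+ p * (+ i + + 1) - (+ 1 + j))) n/p≡a +n≡ ⟩
    + a * (+ p * (+ a + + 1) - (+ 1 + (+ a * + p + + b)))
      ≡⟨ simplify (+ a) (+ p) (+ b) ⟩
    + a * (+ p - + 1 - + b)
      ∎
    where
    open ≡-Reasoning
    weight : ℕ → ℤ
    weight k = + 2 * + k - + suc n
    n/p≡a : n / p ≡ a
    n/p≡a = trans (cong (_/ p) (trans n≡ap+b (ℕ.+-comm (a *ℕ p) b))) ([r+qd]/d≡q a p b<p)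
    +n≡ : + n ≡ + a * + p + + b
    +n≡ = trans (cong +_ n≡ap+b) (cong (_+ + b) (ℤ.pos-* a p))
    simplify : ∀ x y z → x * (y * (x + + 1) - (+ 1 + (x * y + z))) ≡ x * (y - + 1 - z)
    simplify = solve-∀

-- Specialisation to N = p² - 1

module Below-p² (p-1 : ℕ) (p-prime : Prime (suc p-1)) where

  -- With the prime given as a successor, `p ∸ 1` computes to `p-1` and `N` unfolds without case
  -- distinction.
  p N : ℕ
  p = suc p-1
  N = p ^ 2 ∸ 1

  -- Both base p digits of p² - 1 are p - 1.
  N≡ : N ≡ p-1 +ℕ p-1 *ℕ p
  N≡ = cong (λ m → m +ℕ p-1 *ℕ suc m) (ℕ.*-identityʳ p-1)

  N<p² : N < p *ℕ p
  N<p² = s≤s (ℕ.≤-reflexive N≡)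

  N/p≡p-1 : N / p ≡ p-1
  N/p≡p-1 = trans (cong (_/ p) N≡) ([r+qd]/d≡q p-1 p ℕ.≤-refl)

  module _ (k : ℕ) .{{_ : NonZero k}} where

    N/k<p² : N / k < p *ℕ p
    N/k<p² = ℕ.≤-<-trans (m/n≤m N k) N<p²

    -- Successive floor divisions commute, and dividing by p first leaves p - 1.
    N/k/p≡p-1/k : N / k / p ≡ p-1 / k
    N/k/p≡p-1/k = begin
      N / k / p      ≡⟨ m/n/o≡m/[n*o] N k p ⟩
      N / (k *ℕ p)   ≡⟨ /-congʳ (ℕ.*-comm k p) ⟩
      N / (p *ℕ k)   ≡⟨ m/n/o≡m/[n*o] N p k ⟨
      N / p / k      ≡⟨ cong (_/ k) N/p≡p-1 ⟩
      p-1 / k        ∎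
      where
      open ≡-Reasoning
      instance
        kp≢0 : NonZero (k *ℕ p)
        kp≢0 = ℕ.m*n≢0 k p
        pk≢0 : NonZero (p *ℕ k)
        pk≢0 = ℕ.m*n≢0 p k

    digits-exist : ∃₂ λ a b → a ≤ p-1 × b ≤ p-1 × N / k ≡ a *ℕ p +ℕ b
    digits-exist = N / k / p , (N / k) % p
                 , s≤s⁻¹ (m<n*o⇒m/o<n N/k<p²)
                 , s≤s⁻¹ (m%n<n (N / k) p)
                 , trans (m≡m%n+[m/n]*n (N / k) p) (ℕ.+-comm ((N / k) % p) (N / k / p *ℕ p))

    -- As b < p, division by p returns a; then b is what remains, expressed in ℤ to avoid truncated
    -- subtraction.
    digits-unique : ∀ a b → b ≤ p-1 → N / k ≡ a *ℕ p +ℕ b →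
      a ≡ p-1 / k × + b ≡ + (N / k) - + p * + (p-1 / k)
    digits-unique a b b≤p-1 N/k≡ap+b = a≡ , +b≡
      where
      open ≡-Reasoning
      a≡ : a ≡ p-1 / k
      a≡ = begin
        a                      ≡⟨ [r+qd]/d≡q a p (s≤s b≤p-1) ⟨
        (b +ℕ a *ℕ p) / p      ≡⟨ cong (_/ p) (trans (ℕ.+-comm b (a *ℕ p)) (sym N/k≡ap+b)) ⟩
        N / k / p              ≡⟨ N/k/p≡p-1/k ⟩
        p-1 / k                ∎
      cancel : ∀ x y z → z ≡ x * y + z - y * x
      cancel = solve-∀
      +b≡ : + b ≡ + (N / k) - + p * + (p-1 / k)
      +b≡ = begin
        + b                               ≡⟨ cancel (+ a) (+ p) (+ b) ⟩
        + a * + p + + b - + p * + a       ≡⟨ cong (λ i → i + + b - + p * + a) (ℤ.pos-* a p) ⟨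
        + (a *ℕ p +ℕ b) - + p * + a       ≡⟨ cong₂ (λ m i → + m - + p * + i) (sym N/k≡ap+b) a≡ ⟩
        + (N / k) - + p * + (p-1 / k)     ∎

    ordG̅-N/k : ordG̅ p (N / k) ≡ + (p-1 / k) * (+ p - + 1 - (+ (N / k) - + p * + (p-1 / k)))
    ordG̅-N/k =
      let a , b , _ , b≤p-1 , N/k≡ap+b = digits-exist
          a≡ , +b≡ = digits-unique a b b≤p-1 N/k≡ap+b
      in trans (ordG̅-digits p-prime a b N/k<p² (s≤s b≤p-1) N/k≡ap+b)
               (cong₂ (λ i j → + i * (+ p - + 1 - j)) a≡ +b≡)

    -- For k ≥ p the quotient N / k is below p, so its leading digit is 0 and the product formula
    -- vanishes.
    ordG̅-large : p-1 < k → ordG̅ p (N / k) ≡ + 0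
    ordG̅-large p-1<k = ordG̅-digits p-prime 0 (N / k) N/k<p²
      (m<n*o⇒m/o<n (ℕ.<-≤-trans N<p² (ℕ.*-monoʳ-≤ p p-1<k))) refl

  ordF̅-N : ordF̅ p N ≡ ∑ p-1 (λ k → μ k * ordG̅ p (N / k))
  ordF̅-N = trans (ordF̅≡∑-ordG̅ p N) (∑-truncate N (λ k → μ k * ordG̅ p (N / k)) p-1≤N
    λ k p-1<k _ → trans (cong (μ k *_) (ordG̅-large k p-1<k)) (ℤ.*-zeroʳ (μ k)))
    where
    p-1≤N : p-1 ≤ N
    p-1≤N = subst (p-1 ≤_) (sym N≡) (ℕ.m≤m+n p-1 (p-1 *ℕ p))

  -- Splitting p - 1 - b into (p - 1) and b, the first part carries the factor Σ μ(k) ⌊(p-1)/k⌋,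
  -- which is 1 by `∑-μ-floor`.
  ordF̅-N-digits : .{{_ : NonZero p-1}} → ordF̅ p N ≡
    (+ p - + 1) - ∑ p-1 (λ k → μ k * + (p-1 / k) * (+ (N / k) - + p * + (p-1 / k)))
  ordF̅-N-digits = begin
    ordF̅ p N
      ≡⟨ ordF̅-N ⟩
    ∑ p-1 (λ k → μ k * ordG̅ p (N / k))
      ≡⟨ ∑-cong p-1 (λ k _ → trans (cong (μ k *_) (ordG̅-N/k k)) (distrib (μ k) (+ (p-1 / k)) (+ p - + 1) (b k))) ⟩
    ∑ p-1 (λ k → μ k * + (p-1 / k) * (+ p - + 1) - μ k * + (p-1 / k) * b k)
      ≡⟨ ∑-- p-1 (λ k → μ k * + (p-1 / k) * (+ p - + 1)) (λ k → μ k * + (p-1 / k) * b k) ⟩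
    ∑ p-1 (λ k → μ k * + (p-1 / k) * (+ p - + 1)) - ∑b
      ≡⟨ cong (_- ∑b) (∑-*ʳ p-1 (+ p - + 1) (λ k → μ k * + (p-1 / k))) ⟩
    ∑ p-1 (λ k → μ k * + (p-1 / k)) * (+ p - + 1) - ∑b
      ≡⟨ cong (λ i → i * (+ p - + 1) - ∑b) (∑-μ-floor p-1) ⟩
    + 1 * (+ p - + 1) - ∑b
      ≡⟨ cong (_- ∑b) (ℤ.*-identityˡ (+ p - + 1)) ⟩
    (+ p - + 1) - ∑b
      ∎
    where
    open ≡-Reasoning
    b : Summand
    b k = + (N / k) - + p * + (p-1 / k)
    ∑b : ℤ
    ∑b = ∑ p-1 (λ k → μ k * + (p-1 / k) * b k)
    distrib : ∀ x y z w → x * (y * (z - w)) ≡ x * y * z - x * y * w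
    distrib = solve-∀

theorem4p8 : (p : ℕ) → Prime p → 3 ≤ p →
    -- (1)
    (ordF̅ p (p ^ 2 ∸ 1) ≡ ∑₁ (p ∸ 1) (λ k → μ k * ordG̅ p ((p ^ 2 ∸ 1) / k)))
    ×
    -- (2)
    ((k : ℕ) .{{_ : NonZero k}} → k ≤ p ∸ 1 →
      (∃₂ λ a b → a ≤ p ∸ 1 × b ≤ p ∸ 1 × (p ^ 2 ∸ 1) / k ≡ a *ℕ p +ℕ b)
      ×
      ((a b : ℕ) → a ≤ p ∸ 1 → b ≤ p ∸ 1 → (p ^ 2 ∸ 1) / k ≡ a *ℕ p +ℕ b →
        (ordG̅ p ((p ^ 2 ∸ 1) / k) ≡ + a * (+ p - + 1 - + b))
        × (a ≡ (p ∸ 1) / k)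
        × (+ b ≡ + ((p ^ 2 ∸ 1) / k) - + p * + ((p ∸ 1) / k))))
    ×
    -- (3)
    (ordF̅ p (p ^ 2 ∸ 1) ≡
      (+ p - + 1) - ∑₁ (p ∸ 1) (λ k → μ k * + ((p ∸ 1) / k) *
        (+ ((p ^ 2 ∸ 1) / k) - + p * + ((p ∸ 1) / k))))
-- Matching `p-1` as a successor supplies the instance `NonZero p-1` that (3) takes from
-- `ordF̅-N-digits`.
theorem4p8 (suc p-1@(suc _)) p-prime _ =
    trans ordF̅-N (sym (∑₁≡∑ p-1 (λ k → μ k * ordG̅ p (N / k))))
  , (λ k _ → digits-exist k
           , λ a b _ b≤p-1 N/k≡ap+b →
               ordG̅-digits p-prime a b (N/k<p² k) (s≤s b≤p-1) N/k≡ap+b , digits-unique k a b b≤p-1 N/k≡ap+b)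
  , trans ordF̅-N-digits
      (cong (_-_ (+ p - + 1)) (sym (∑₁≡∑ p-1 (λ k → μ k * + (p-1 / k) * (+ (N / k) - + p * + (p-1 / k))))))
  where open Below-p² p-1 p-prime
theorem4p8 (suc zero) _ (s≤s ())
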